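{- If $T$ is a tree, then $\gamma_{\rm i}(T)=\alpha(T)$.
   Context: $\alpha(T)$ is the independence number. Indicated domination game on a graph $G$: two players, Dominator and Staller, alternate. In each round Dominator indicates a vertex $v$ not yet dominated by the vertices previously selected by Staller (a vertex dominates itself and its neighbors), and Staller must select a vertex of the closed neighborhood $N[v]$, adding it to a set $D$. The game ends when $D$ is a dominating set of $G$. Dominator wants to minimize $|D|$ and Staller to maximize it; the size of $D$ under optimal play of both is the indicated domination number $\gamma_{\rm i}(G)$. -}

module Defs where

open import Data.Fin using (Fin; zero; suc; inject₁; fromℕ)
open import Data.Fin.Properties using (_≟_; any?; all?)
open import Data.Fin.Subset using (Subset; inside; outside; _∈_; _∪_; ⁅_⁆; ∣_∣; ⊤; ⊥)
open import Data.Fin.Subset.Properties using (_∈?_; ∈⊤; ∉⊥; x∈⁅x⁆; p⊆p∪q; q⊆p∪q; ∣p∣≤n; ∣p∣≡n⇒p≡⊤; p⊂q⇒∣p∣<∣q∣; ∣⊥∣≡0)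
open import Data.List using (List; []; _∷_; map; filter; allFin; _++_)
open import Data.List.Extrema.Nat using (min; max; xs≤max; argmax-sel)
open import Data.List.Membership.Propositional renaming (_∈_ to _∈ˡ_) using ()
open import Data.List.Membership.Propositional.Properties using (∈-map⁺; ∈-map⁻; ∈-++⁺ˡ; ∈-++⁺ʳ; ∈-filter⁺; ∈-filter⁻)
open import Data.List.Properties using (map-cong-local; filter-none)
import Data.List.Relation.Unary.All as All
import Data.List.Relation.Unary.All.Properties as All
open import Data.List.Relation.Unary.Any using (here)
open import Data.Nat using (ℕ; zero; suc; _+_; _≤_)
open import Data.Nat.Properties using (≤-antisym; ≤-trans; ≤-reflexive; +-identityʳ; +-suc; +-monoˡ-≤)
open import Data.Product using (∃; _×_; _,_; proj₂)
open import Data.Sum using (_⊎_; inj₁; inj₂)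
open import Data.Vec using ([]; _∷_)
open import Function.Definitions using (Injective)
open import Relation.Binary using (Decidable; Symmetric; Irreflexive)
open import Relation.Binary.Construct.Closure.ReflexiveTransitive using (Star)
open import Relation.Binary.PropositionalEquality using (_≡_; refl; sym; trans; cong; cong₂)
open import Relation.Nullary using (¬_; Dec)
open import Relation.Nullary.Decidable using (¬?; _×-dec_; _⊎-dec_; _→-dec_)

record Graph (n : ℕ) : Set₁ where
  field
    Adj    : Fin n → Fin n → Set
    adj?   : Decidable Adj
    symm   : Symmetric Adj
    irrefl : Irreflexive _≡_ Adj

module _ {n : ℕ} (G : Graph n) where
  open Graph G

  Connected : Set
  Connected = ∀ u v → Star Adj u v

  -- A cycle is c 0, c 1, …, c (2 + k), with at least three, pairwise distinct, vertices.
  record Cycle : Set where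
    field
      k        : ℕ
      c        : Fin (3 + k) → Fin n
      distinct : Injective _≡_ _≡_ c
      step     : ∀ (i : Fin (2 + k)) → Adj (c (inject₁ i)) (c (suc i))
      close    : Adj (c (fromℕ (2 + k))) (c zero)

  record IsTree : Set where
    field
      nonempty  : 1 ≤ n
      connected : Connected
      acyclic   : ¬ Cycle

  Independent : Subset n → Set
  Independent S = ∀ u v → u ∈ S → v ∈ S → ¬ Adj u v

  independent? : ∀ S → Dec (Independent S)
  independent? S = all? λ u → all? λ v → (u ∈? S) →-dec ((v ∈? S) →-dec ¬? (adj? u v))

  InN[_] : Fin n → Fin n → Set
  InN[ v ] w = w ≡ v ⊎ Adj v w

  inN[_]? : ∀ v w → Dec (InN[ v ] w)
  inN[ v ]? w = (w ≟ v) ⊎-dec adj? v w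

  Dominated : Subset n → Fin n → Set
  Dominated D v = ∃ λ u → u ∈ D × InN[ v ] u

  dominated? : ∀ D v → Dec (Dominated D v)
  dominated? D v = any? λ u → (u ∈? D) ×-dec inN[ v ]? u

  undominated : Subset n → List (Fin n)
  undominated D = filter (λ v → ¬? (dominated? D v)) (allFin n)

  closedNbhd : Fin n → List (Fin n)
  closedNbhd v = filter inN[ v ]? (allFin n)

  -- finalSize t D is the final size of the selected set under optimal play from the
  -- position D.  The game is over exactly when no vertex is undominated.  The argument t
  -- only bounds the number of rounds; every selected vertex is new, so the bound is never
  -- reached when n ≤ ∣ D ∣ + t (finalSize-stable).  As closedNbhd v contains v, the 0 in
  -- the maximum is irrelevant.
  mutual
    finalSize : ℕ → Subset n → ℕ
    finalSize zero    D = ∣ D ∣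
    finalSize (suc t) D = indicate t D (undominated D)

    -- Dominator minimises over the vertices that may be indicated.
    indicate : ℕ → Subset n → List (Fin n) → ℕ
    indicate t D []       = ∣ D ∣
    indicate t D (v ∷ vs) = min (select t D v) (map (select t D) vs)

    -- Staller maximises over the closed neighbourhood of the indicated vertex.
    select : ℕ → Subset n → Fin n → ℕ
    select t D v = max 0 (map (λ w → finalSize t (D ∪ ⁅ w ⁆)) (closedNbhd v))

  γᵢ : ℕ
  γᵢ = finalSize n ⊥

  undominated-⊤ : undominated ⊤ ≡ []
  undominated-⊤ = filter-none (λ v → ¬? (dominated? ⊤ v))
    (All.tabulate {xs = allFin n} λ {v} _ v∉ → v∉ (v , ∈⊤ , inj₁ refl))

  select-new : ∀ D {v w} → ¬ Dominated D v → InN[ v ] w → suc ∣ D ∣ ≤ ∣ D ∪ ⁅ w ⁆ ∣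
  select-new D {w = w} ¬dom w∈N = p⊂q⇒∣p∣<∣q∣
    (p⊆p∪q ⁅ w ⁆ , w , q⊆p∪q D ⁅ w ⁆ (x∈⁅x⁆ w) , λ w∈D → ¬dom (w , w∈D , w∈N))

  finalSize-stable : ∀ t D → n ≤ ∣ D ∣ + t → finalSize (suc t) D ≡ finalSize t D
  finalSize-stable zero D n≤ with ∣p∣≡n⇒p≡⊤ {p = D} (≤-antisym (∣p∣≤n D) (≤-trans n≤ (≤-reflexive (+-identityʳ _))))
  ... | refl = cong (indicate zero ⊤) undominated-⊤
  finalSize-stable (suc t) D n≤ = indicate-stable (undominated D)
    (All.all-filter (λ v → ¬? (dominated? D v)) (allFin n))
    where
    select-stable : ∀ {v} → ¬ Dominated D v → select (suc t) D v ≡ select t D v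
    select-stable {v} ¬dom = cong (max 0) (map-cong-local
      (All.map (λ {w} w∈N → finalSize-stable t (D ∪ ⁅ w ⁆)
          (≤-trans n≤ (≤-trans (≤-reflexive (+-suc ∣ D ∣ t)) (+-monoˡ-≤ t (select-new D ¬dom w∈N)))))
        (All.all-filter inN[ v ]? (allFin n))))

    indicate-stable : ∀ vs → All.All (λ v → ¬ Dominated D v) vs → indicate (suc t) D vs ≡ indicate t D vs
    indicate-stable []       All.[]         = refl
    indicate-stable (v ∷ vs) (px All.∷ pxs) =
      cong₂ min (select-stable px) (map-cong-local (All.map select-stable pxs))

subsets : ∀ n → List (Subset n)
subsets zero    = [] ∷ []
subsets (suc n) = map (inside ∷_) (subsets n) ++ map (outside ∷_) (subsets n)

∈-subsets : ∀ {n} (S : Subset n) → S ∈ˡ subsets n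
∈-subsets []            = here refl
∈-subsets (inside  ∷ S) = ∈-++⁺ˡ (∈-map⁺ (inside ∷_) (∈-subsets S))
∈-subsets (outside ∷ S) = ∈-++⁺ʳ (map (inside ∷_) (subsets _)) (∈-map⁺ (outside ∷_) (∈-subsets S))

module _ {n : ℕ} (G : Graph n) where

  α : ℕ
  α = max 0 (map ∣_∣ (filter (independent? G) (subsets n)))

  α-upper : ∀ S → Independent G S → ∣ S ∣ ≤ α
  α-upper S ind = All.lookup (xs≤max 0 _)
    (∈-map⁺ ∣_∣ (∈-filter⁺ (independent? G) (∈-subsets S) ind))

  α-attained : ∃ λ S → Independent G S × ∣ S ∣ ≡ α
  α-attained with argmax-sel (λ k → k) 0 (map ∣_∣ (filter (independent? G) (subsets n)))
  ... | inj₁ α≡0 = ⊥ , (λ u v u∈ _ _ → ∉⊥ u∈) , trans (∣⊥∣≡0 n) (sym α≡0)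
  ... | inj₂ α∈ with ∈-map⁻ ∣_∣ α∈
  ... | S , S∈ , α≡ = S , proj₂ (∈-filter⁻ (independent? G) {xs = subsets n} S∈) , sym α≡

{-# OPTIONS --safe #-}

-- Lower bound (any graph): Staller fixes a maximum independent set I and always selects
-- a vertex of I; being maximal, I meets every closed neighbourhood.  The final set D ⊆ I
-- dominates I, and a vertex of I is dominated only by itself within I, so D = I.
--
-- Upper bound (any forest): Dominator can finish within α moves even against an adversary
-- who may at any time declare further vertices dominated for free.  Let l have at most one
-- neighbour s in the forest F, and let F′ = F − N[l], so that α(F) ≥ α(F′) + 1.
-- Dominator follows his strategy for F′ and finally needs at most one move for {l , s}.  If
-- Staller answers within F′ by s, then l and s are both dominated, so this move is the one
-- reserved for {l , s}, and in F′ its effect is a free domination.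
module Submission where

open import Defs
open import Data.Empty using (⊥-elim)
open import Data.Fin using (Fin; toℕ)
import Data.Fin as Fin
open import Data.Fin.Properties using (_≟_; any?; <-cmp; pigeonhole; toℕ-inject₁; toℕ-fromℕ; toℕ<n)
open import Data.Fin.Subset using (Subset; inside; outside; _∈_; _∉_; _⊆_; _∪_; ⁅_⁆; ∣_∣; ⊤; ⊥)
open import Data.Fin.Subset.Properties using (_∈?_; ∈⊤; ∉⊥; x∈⁅x⁆; x∈⁅y⁆⇒x≡y; x∈p∪q⁻; p⊆p∪q; q⊆p∪q; ∣p∣≤n; ∣⊥∣≡0; p⊆q⇒∣p∣≤∣q∣; p⊂q⇒∣p∣<∣q∣; ⊆-refl; ⊆-trans; nonempty?; ∣⁅x⁆∣≡1)
open import Data.List using ([]; _∷_; map; allFin)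
open import Data.List.Extrema.Nat using (min≤v⁺; v≤min⁺; max≤v⁺; v≤max⁺)
open import Data.List.Membership.Propositional using (lose) renaming (_∈_ to _∈ˡ_)
open import Data.List.Membership.Propositional.Properties using (∈-map⁺; ∈-filter⁺; ∈-allFin)
import Data.List.Relation.Unary.All as All
import Data.List.Relation.Unary.All.Properties as All
open import Data.List.Relation.Unary.Any using (here; there)
open import Data.Nat using (ℕ; zero; suc; _+_; _∸_; _≤_; _<_; z≤n; s≤s)
open import Data.Nat.Induction using (Acc; acc; <-wellFounded)
open import Data.Nat.Properties using (≤-reflexive; ≤-trans; ≤-antisym; <⇒≤; <⇒≱; m≤m+n; m≤n⇒m≤1+n; +-suc; +-assoc; +-comm; +-identityʳ; +-monoˡ-≤; m∸n+n≡m; m∸n≤m; m<n⇒0<n∸m; ≤-<-trans; n<1+n; module ≤-Reasoning)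
open import Data.Product using (∃; ∃₂; _×_; _,_; proj₁; proj₂)
open import Data.Sum using (_⊎_; inj₁; inj₂)
open import Data.Vec using ([]; _∷_; tabulate)
open import Data.Vec.Properties using (lookup∘tabulate; lookup⇒[]=; []=⇒lookup)
open import Function using (_∘_)
open import Relation.Binary using (tri<; tri≈; tri>)
open import Relation.Binary.PropositionalEquality using (_≡_; _≢_; refl; sym; trans; cong; subst; subst₂)
open import Relation.Nullary using (¬_; Dec; yes; no; does)
open import Relation.Nullary.Decidable using (¬?; _×-dec_; dec-true; decidable-stable)
open import Relation.Unary using (Decidable)

-- Subsets cut out by decidable predicates, and sizes of unions.

comprehension : ∀ {n} {P : Fin n → Set} → Decidable P → Subset n
comprehension P? = tabulate (does ∘ P?)

module _ {n : ℕ} {P : Fin n → Set} (P? : Decidable P) where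

  ∈-comprehension⁺ : ∀ {v} → P v → v ∈ comprehension P?
  ∈-comprehension⁺ {v} pv =
    lookup⇒[]= v _ (trans (lookup∘tabulate (does ∘ P?) v) (dec-true (P? v) pv))

  ∈-comprehension⁻ : ∀ {v} → v ∈ comprehension P? → P v
  ∈-comprehension⁻ {v} v∈ with P? v | trans (sym (lookup∘tabulate (does ∘ P?) v)) ([]=⇒lookup v∈)
  ... | yes pv | _ = pv
  ... | no _   | ()

x∉p⇒∣p∣<∣p∪⁅x⁆∣ : ∀ {n} {p : Subset n} {x} → x ∉ p → ∣ p ∣ < ∣ p ∪ ⁅ x ⁆ ∣
x∉p⇒∣p∣<∣p∪⁅x⁆∣ {p = p} {x} x∉p =
  p⊂q⇒∣p∣<∣q∣ (p⊆p∪q ⁅ x ⁆ , x , q⊆p∪q p ⁅ x ⁆ (x∈⁅x⁆ x) , x∉p)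

∣p∪q∣≤∣p∣+∣q∣ : ∀ {n} (p q : Subset n) → ∣ p ∪ q ∣ ≤ ∣ p ∣ + ∣ q ∣
∣p∪q∣≤∣p∣+∣q∣ []            []            = z≤n
∣p∪q∣≤∣p∣+∣q∣ (outside ∷ p) (outside ∷ q) = ∣p∪q∣≤∣p∣+∣q∣ p q
∣p∪q∣≤∣p∣+∣q∣ (inside  ∷ p) (outside ∷ q) = s≤s (∣p∪q∣≤∣p∣+∣q∣ p q)
∣p∪q∣≤∣p∣+∣q∣ (outside ∷ p) (inside  ∷ q) rewrite +-suc ∣ p ∣ ∣ q ∣ = s≤s (∣p∪q∣≤∣p∣+∣q∣ p q)
∣p∪q∣≤∣p∣+∣q∣ (inside  ∷ p) (inside  ∷ q) rewrite +-suc ∣ p ∣ ∣ q ∣ = s≤s (m≤n⇒m≤1+n (∣p∪q∣≤∣p∣+∣q∣ p q))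

∣p∪⁅x⁆∣≤1+∣p∣ : ∀ {n} (p : Subset n) x → ∣ p ∪ ⁅ x ⁆ ∣ ≤ suc ∣ p ∣
∣p∪⁅x⁆∣≤1+∣p∣ p x = ≤-trans (∣p∪q∣≤∣p∣+∣q∣ p ⁅ x ⁆)
  (≤-reflexive (trans (cong (∣ p ∣ +_) (∣⁅x⁆∣≡1 x)) (+-comm ∣ p ∣ 1)))

-- Maximum independent sets, and bounds on the value of one round.

module _ {n : ℕ} (G : Graph n) where
  open Graph G

  InN-sym : ∀ {v w} → InN[_] G v w → InN[_] G w v
  InN-sym (inj₁ refl) = inj₁ refl
  InN-sym (inj₂ v~w)  = inj₂ (symm v~w)

  independent-∪⁅⁆ : ∀ {I v} → Independent G I → (∀ {w} → w ∈ I → ¬ Adj v w) →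
                    Independent G (I ∪ ⁅ v ⁆)
  independent-∪⁅⁆ {I} {v} ind v≁I x y x∈ y∈ x~y with x∈p∪q⁻ I ⁅ v ⁆ x∈ | x∈p∪q⁻ I ⁅ v ⁆ y∈
  ... | inj₁ x∈I | inj₁ y∈I = ind x y x∈I y∈I x~y
  ... | inj₁ x∈I | inj₂ y∈v rewrite x∈⁅y⁆⇒x≡y v y∈v = v≁I x∈I (symm x~y)
  ... | inj₂ x∈v | inj₁ y∈I rewrite x∈⁅y⁆⇒x≡y v x∈v = v≁I y∈I x~y
  ... | inj₂ x∈v | inj₂ y∈v = irrefl (trans (x∈⁅y⁆⇒x≡y v x∈v) (sym (x∈⁅y⁆⇒x≡y v y∈v))) x~y

  -- A vertex undominated by `I` could be added to `I`, giving an independent set with more than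
  -- `α G` vertices.
  maximum-dominates : ∀ {I} → Independent G I → ∣ I ∣ ≡ α G → ∀ v → Dominated G I v
  maximum-dominates {I} ind ∣I∣≡α v = decidable-stable (dominated? G I v) λ ¬dom →
    <⇒≱ (x∉p⇒∣p∣<∣p∪⁅x⁆∣ (λ v∈I → ¬dom (v , v∈I , inj₁ refl)))
        (≤-trans (α-upper G (I ∪ ⁅ v ⁆) (independent-∪⁅⁆ ind λ w∈I v~w → ¬dom (_ , w∈I , inj₂ v~w)))
                 (≤-reflexive (sym ∣I∣≡α)))

  undominated⁺ : ∀ D {v} → ¬ Dominated G D v → v ∈ˡ undominated G D
  undominated⁺ D = ∈-filter⁺ (λ v → ¬? (dominated? G D v)) (∈-allFin _)

  undominated⁻ : ∀ D → All.All (λ v → ¬ Dominated G D v) (undominated G D)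
  undominated⁻ D = All.all-filter (λ v → ¬? (dominated? G D v)) (allFin n)

  select-≥ : ∀ t D {k v w} → InN[_] G v w → k ≤ finalSize G t (D ∪ ⁅ w ⁆) → k ≤ select G t D v
  select-≥ t D {v = v} w∈N k≤ = v≤max⁺ 0 _
    (inj₂ (lose (∈-map⁺ _ (∈-filter⁺ (inN[_]? G v) (∈-allFin _) w∈N)) k≤))

  select-≤ : ∀ t D {k v} → (∀ {w} → InN[_] G v w → finalSize G t (D ∪ ⁅ w ⁆) ≤ k) → select G t D v ≤ k
  select-≤ t D {v = v} ≤k = max≤v⁺ z≤n (All.map⁺ (All.map ≤k (All.all-filter (inN[_]? G v) (allFin n))))

  -- The disjunction is for the empty list, where the value is `∣ D ∣` and the bounds in `All` say
  -- nothing.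
  indicate-≥ : ∀ t D {k vs} → k ≤ ∣ D ∣ ⊎ ∃ (_∈ˡ vs) → All.All (λ v → k ≤ select G t D v) vs →
               k ≤ indicate G t D vs
  indicate-≥ t D {vs = []}    (inj₁ k≤)  _               = k≤
  indicate-≥ t D {vs = _ ∷ _} _          (k≤ All.∷ k≤s)  = v≤min⁺ k≤ (All.map⁺ k≤s)

  indicate-≤ : ∀ t D {k v vs} → v ∈ˡ vs → select G t D v ≤ k → indicate G t D vs ≤ k
  indicate-≤ t D {vs = _ ∷ vs} (here refl) ≤k = min≤v⁺ _ (map (select G t D) vs) (inj₁ ≤k)
  indicate-≤ t D {vs = _ ∷ vs} (there v∈)  ≤k = min≤v⁺ _ (map (select G t D) vs) (inj₂ (lose (∈-map⁺ _ v∈) ≤k))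

  -- Lower bound: Staller plays inside an independent dominating set.

  module _ {I : Subset n} (ind : Independent G I) (dom : ∀ v → Dominated G I v) where

    ∣I∣≤finalSize : ∀ t D → D ⊆ I → n ≤ ∣ D ∣ + t → ∣ I ∣ ≤ finalSize G t D
    -- With no rounds left, `n ≤ ∣ D ∣`, which bounds the size of every subset.
    ∣I∣≤finalSize zero    D D⊆I n≤ = ≤-trans (∣p∣≤n I) (≤-trans n≤ (≤-reflexive (+-identityʳ _)))
    ∣I∣≤finalSize (suc t) D D⊆I n≤ = indicate-≥ t D over? (All.map reply (undominated⁻ D))
      where
      over? : ∣ I ∣ ≤ ∣ D ∣ ⊎ ∃ (_∈ˡ undominated G D)
      over? with any? (λ v → ¬? (dominated? G D v))
      ... | yes (v , ¬dom) = inj₂ (v , undominated⁺ D ¬dom)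
      ... | no  all-dom    = inj₁ (p⊆q⇒∣p∣≤∣q∣ I⊆D)
        where
        I⊆D : I ⊆ D
        I⊆D {i} i∈I with decidable-stable (dominated? G D i) (λ ¬dom → all-dom (i , ¬dom))
        ... | .i , i∈D , inj₁ refl = i∈D
        ... | u  , u∈D , inj₂ i~u  = ⊥-elim (ind i u i∈I (D⊆I u∈D) i~u)

      reply : ∀ {v} → ¬ Dominated G D v → ∣ I ∣ ≤ select G t D v
      reply {v} ¬dom with dom v
      ... | w , w∈I , w∈N = select-≥ t D w∈N (∣I∣≤finalSize t (D ∪ ⁅ w ⁆) D∪w⊆I
              (≤-trans n≤ (≤-trans (≤-reflexive (+-suc ∣ D ∣ t)) (+-monoˡ-≤ t (select-new G D ¬dom w∈N)))))
        where
        D∪w⊆I : D ∪ ⁅ w ⁆ ⊆ I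
        D∪w⊆I x∈ with x∈p∪q⁻ D ⁅ w ⁆ x∈
        ... | inj₁ x∈D = D⊆I x∈D
        ... | inj₂ x∈w rewrite x∈⁅y⁆⇒x≡y w x∈w = w∈I

  α≤γᵢ : α G ≤ γᵢ G
  α≤γᵢ with α-attained G
  ... | I , ind , ∣I∣≡α = subst (_≤ γᵢ G) ∣I∣≡α
    (∣I∣≤finalSize ind (maximum-dominates ind ∣I∣≡α) n ⊥ (⊥-elim ∘ ∉⊥) (≤-reflexive (sym (cong (_+ n) (∣⊥∣≡0 n)))))

  -- The restricted game and the removal of a leaf.

  -- The game restricted to the subgraph induced by F: from the set X of dominated vertices,
  -- Dominator finishes within m moves, although the adversary may enlarge the dominated set
  -- both before a vertex is indicated (to Y) and after the reply (to Z).
  FinishesWithin : Subset n → ℕ → Subset n → Set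
  FinishesWithin F zero    X = F ⊆ X
  FinishesWithin F (suc m) X = ∀ {Y} → X ⊆ Y → F ⊆ Y ⊎ ∃ λ v → v ∈ F × v ∉ Y ×
    (∀ {w Z} → w ∈ F → InN[_] G v w → Y ⊆ Z → (∀ {u} → u ∈ F → InN[_] G w u → u ∈ Z) → FinishesWithin F m Z)

  finishes-mono : ∀ {F} m {X Y} → X ⊆ Y → FinishesWithin F m X → FinishesWithin F m Y
  finishes-mono zero    X⊆Y F⊆X   = ⊆-trans F⊆X X⊆Y
  finishes-mono (suc m) X⊆Y r Y⊆Z = r (⊆-trans X⊆Y Y⊆Z)

  finished : ∀ {F} m {X} → F ⊆ X → FinishesWithin F m X
  finished zero    F⊆X     = F⊆X
  finished (suc m) F⊆X X⊆Y = inj₁ (⊆-trans F⊆X X⊆Y)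

  _≤1-neighbour-in_ : Fin n → Subset n → Set
  l ≤1-neighbour-in F = ∀ {x y} → x ∈ F → y ∈ F → Adj l x → Adj l y → x ≡ y

  outside? : ∀ F l → Decidable (λ v → v ∈ F × ¬ InN[_] G l v)
  outside? F l v = (v ∈? F) ×-dec ¬? (inN[_]? G l v)

  _∖N[_] : Subset n → Fin n → Subset n
  F ∖N[ l ] = comprehension (outside? F l)

  module _ {F : Subset n} {l : Fin n} (l∈F : l ∈ F) (leaf : l ≤1-neighbour-in F) where

    private
      F′ = F ∖N[ l ]

      split : ∀ {v} → v ∈ F → v ∈ F′ ⊎ InN[_] G l v
      split {v} v∈F with inN[_]? G l v
      ... | yes v∈N = inj₂ v∈N
      ... | no  v∉N = inj₁ (∈-comprehension⁺ (outside? F l) (v∈F , v∉N))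

      ⊆F : ∀ {v} → v ∈ F′ → v ∈ F
      ⊆F = proj₁ ∘ ∈-comprehension⁻ (outside? F l)

      ∉N : ∀ {v} → v ∈ F′ → ¬ InN[_] G l v
      ∉N = proj₂ ∘ ∈-comprehension⁻ (outside? F l)

      -- Within `F`, `N[l]` is `{l}` or an edge `{l , s}`, so any reply inside it dominates all of
      -- it.
      N[l]-clique : ∀ {u w} → u ∈ F → w ∈ F → InN[_] G l u → InN[_] G l w → InN[_] G w u
      N[l]-clique u∈F w∈F (inj₁ refl) w∈N         = InN-sym w∈N
      N[l]-clique u∈F w∈F (inj₂ l~u)  (inj₁ refl) = inj₂ l~u
      N[l]-clique u∈F w∈F (inj₂ l~u)  (inj₂ l~w)  = inj₁ (leaf u∈F w∈F l~u l~w)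

    -- Only l and its neighbour s can still be undominated. If l is undominated, indicating l forces
    -- a reply in `N[l]`, which dominates both.
    one-move-left : ∀ m {X} → F′ ⊆ X → FinishesWithin F (suc m) X
    one-move-left m {X} F′⊆X {Y} X⊆Y with l ∈? Y
    ... | no l∉Y = inj₂ (l , l∈F , l∉Y , λ w∈F w∈N Y⊆Z covered → finished m λ u∈F → last w∈F w∈N Y⊆Z covered u∈F (split u∈F))
      where
      last : ∀ {w Z u} → w ∈ F → InN[_] G l w → Y ⊆ Z → (∀ {u} → u ∈ F → InN[_] G w u → u ∈ Z) →
             u ∈ F → u ∈ F′ ⊎ InN[_] G l u → u ∈ Z
      last w∈F w∈N Y⊆Z covered u∈F (inj₁ u∈F′) = Y⊆Z (X⊆Y (F′⊆X u∈F′))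
      last w∈F w∈N Y⊆Z covered u∈F (inj₂ u∈N)  = covered u∈F (N[l]-clique u∈F w∈F u∈N w∈N)
    ... | yes l∈Y with any? (λ v → (v ∈? F) ×-dec ¬? (v ∈? Y))
    ... | no  none = inj₁ λ {u} u∈F → decidable-stable (u ∈? Y) λ u∉Y → none (u , u∈F , u∉Y)
    -- As l and `F′` are dominated, `v` can only be s, and any reply to it finishes.
    ... | yes (v , v∈F , v∉Y) = inj₂ (v , v∈F , v∉Y , λ w∈F w∈N Y⊆Z covered →
            finished m λ u∈F → last Y⊆Z (covered v∈F (InN-sym w∈N)) u∈F (split u∈F) (split v∈F))
      where
      last : ∀ {Z u} → Y ⊆ Z → v ∈ Z → u ∈ F → u ∈ F′ ⊎ InN[_] G l u → v ∈ F′ ⊎ InN[_] G l v → u ∈ Z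
      last Y⊆Z v∈Z u∈F (inj₁ u∈F′)       _                  = Y⊆Z (X⊆Y (F′⊆X u∈F′))
      last Y⊆Z v∈Z u∈F (inj₂ (inj₁ refl)) _                 = Y⊆Z l∈Y
      last Y⊆Z v∈Z u∈F (inj₂ (inj₂ l~u)) (inj₁ v∈F′)        = ⊥-elim (v∉Y (X⊆Y (F′⊆X v∈F′)))
      last Y⊆Z v∈Z u∈F (inj₂ (inj₂ l~u)) (inj₂ (inj₁ refl)) = ⊥-elim (v∉Y l∈Y)
      last Y⊆Z v∈Z u∈F (inj₂ (inj₂ l~u)) (inj₂ (inj₂ l~v))  = subst (_∈ _) (leaf v∈F u∈F l~v l~u) v∈Z

    -- Dominating all of N[N[l]], not merely N[l], rules out any later reply in N[l].
    finishes-N²-dominated : ∀ m {X} → (∀ {w u} → w ∈ F → u ∈ F → InN[_] G l w → InN[_] G w u → u ∈ X) →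
                            FinishesWithin F′ m X → FinishesWithin F m X
    finishes-N²-dominated zero {X} N²⊆X F′⊆X u∈F with split u∈F
    ... | inj₁ u∈F′ = F′⊆X u∈F′
    ... | inj₂ u∈N  = N²⊆X l∈F u∈F (inj₁ refl) u∈N
    finishes-N²-dominated (suc m) N²⊆X r {Y} X⊆Y with r X⊆Y
    ... | inj₁ F′⊆Y = inj₁ (finishes-N²-dominated zero (λ w∈F u∈F w∈N u∈N → X⊆Y (N²⊆X w∈F u∈F w∈N u∈N)) F′⊆Y)
    ... | inj₂ (v , v∈F′ , v∉Y , next) = inj₂ (v , ⊆F v∈F′ , v∉Y , reply)
      where
      reply : ∀ {w Z} → w ∈ F → InN[_] G v w → Y ⊆ Z → (∀ {u} → u ∈ F → InN[_] G w u → u ∈ Z) → FinishesWithin F m Z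
      reply w∈F w∈N Y⊆Z covered with split w∈F
      ... | inj₁ w∈F′  = finishes-N²-dominated m (λ x∈F u∈F x∈N u∈N → Y⊆Z (X⊆Y (N²⊆X x∈F u∈F x∈N u∈N)))
                           (next w∈F′ w∈N Y⊆Z (λ u∈F′ → covered (⊆F u∈F′)))
      ... | inj₂ w∈N[l] = ⊥-elim (v∉Y (X⊆Y (N²⊆X w∈F (⊆F v∈F′) w∈N[l] (InN-sym w∈N))))

    finishes-leaf : ∀ m {X} → FinishesWithin F′ m X → FinishesWithin F (suc m) X
    finishes-leaf zero    F′⊆X = one-move-left zero F′⊆X
    finishes-leaf (suc m) r {Y} X⊆Y with r X⊆Y
    ... | inj₁ F′⊆Y = one-move-left (suc m) F′⊆Y ⊆-refl
    ... | inj₂ (v , v∈F′ , v∉Y , next) = inj₂ (v , ⊆F v∈F′ , v∉Y , reply)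
      where
      reply : ∀ {w Z} → w ∈ F → InN[_] G v w → Y ⊆ Z → (∀ {u} → u ∈ F → InN[_] G w u → u ∈ Z) →
              FinishesWithin F (suc m) Z
      reply {w} {Z} w∈F w∈N Y⊆Z covered with split w∈F
      ... | inj₁ w∈F′        = finishes-leaf m (next w∈F′ w∈N Y⊆Z (λ u∈F′ → covered (⊆F u∈F′)))
      -- Staller cannot answer by l, since `v` lies outside `N[l]`.
      ... | inj₂ (inj₁ refl) = ⊥-elim (∉N v∈F′ (InN-sym w∈N))
      -- Here `w` is s. This round uses the extra move: the strategy `r`, with all its `suc m`
      -- moves, resumes from the larger set `Z`.
      ... | inj₂ (inj₂ l~w)  = finishes-N²-dominated (suc m) N²⊆Z (finishes-mono (suc m) (⊆-trans X⊆Y Y⊆Z) r)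
        where
        N²⊆Z : ∀ {x u} → x ∈ F → u ∈ F → InN[_] G l x → InN[_] G x u → u ∈ Z
        N²⊆Z {u = u} x∈F u∈F (inj₂ l~x) u∈N rewrite leaf x∈F w∈F l~x l~w = covered u∈F u∈N
        N²⊆Z x∈F u∈F (inj₁ refl) u∈N = covered u∈F (N[l]-clique u∈F w∈F u∈N (inj₂ l~w))

  -- Leaves of forests.

  -- A closed non-backtracking walk of minimal length is a cycle.
  module _ (w : ℕ → Fin n) (walk : ∀ i → Adj (w i) (w (suc i))) (forward : ∀ i → w (2 + i) ≢ w i) where

    closed⇒cycle : ∀ d → Acc _<_ d → ∀ i → 0 < d → w (d + i) ≡ w i → Cycle G
    -- Length 1 would be a loop, and length 2 a step straight back.
    closed⇒cycle 1 _ i _ closed = ⊥-elim (irrefl (sym closed) (walk i))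
    closed⇒cycle 2 _ i _ closed = ⊥-elim (forward i closed)
    closed⇒cycle (suc (suc (suc k))) (acc rec) i _ closed
      -- A repeated vertex within the walk bounds a shorter closed walk; without one the walk is a
      -- cycle.
      with any? (λ (a : Fin (3 + k)) → any? λ (b : Fin (3 + k)) → (a Fin.<? b) ×-dec (w (toℕ b + i) ≟ w (toℕ a + i)))
    ... | yes (a , b , a<b , eq) = closed⇒cycle (toℕ b ∸ toℕ a) (rec (≤-<-trans (m∸n≤m (toℕ b) (toℕ a)) (toℕ<n b)))
            (toℕ a + i) (m<n⇒0<n∸m a<b)
            (trans (cong w (trans (sym (+-assoc (toℕ b ∸ toℕ a) (toℕ a) i)) (cong (_+ i) (m∸n+n≡m (<⇒≤ a<b))))) eq)
    ... | no  none = record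
            { k        = k
            ; c        = λ t → w (toℕ t + i)
            ; distinct = distinct
            ; step     = λ t → subst (λ j → Adj (w (j + i)) (w (suc (toℕ t + i)))) (sym (toℕ-inject₁ t)) (walk (toℕ t + i))
            ; close    = subst₂ (λ j x → Adj (w (j + i)) x) (sym (toℕ-fromℕ (2 + k))) closed (walk (2 + k + i))
            }
      where
      distinct : ∀ {a b : Fin (3 + k)} → w (toℕ a + i) ≡ w (toℕ b + i) → a ≡ b
      distinct {a} {b} eq with <-cmp a b
      ... | tri< a<b _ _ = ⊥-elim (none (a , b , a<b , sym eq))
      ... | tri≈ _ a≡b _ = a≡b
      ... | tri> _ _ b<a = ⊥-elim (none (b , a , b<a , eq))

    -- Two of the positions 0 to `n` carry the same vertex, so the walk has a closed segment of
    -- positive length.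
    forward-walk⇒cycle : Cycle G
    forward-walk⇒cycle with pigeonhole (n<1+n n) (w ∘ toℕ)
    ... | a , b , a<b , eq = closed⇒cycle (toℕ b ∸ toℕ a) (<-wellFounded _) (toℕ a) (m<n⇒0<n∸m a<b)
      (trans (cong w (m∸n+n≡m (<⇒≤ a<b))) (sym eq))

  -- The failure of `v ≤1-neighbour-in F` in existential form, decidable by finite search.
  Branching : Subset n → Fin n → Set
  Branching F v = ∃ λ x → ∃ λ y → (x ∈ F × y ∈ F) × (Adj v x × Adj v y) × x ≢ y

  branching? : ∀ F v → Dec (Branching F v)
  branching? F v = any? λ x → any? λ y →
    ((x ∈? F) ×-dec (y ∈? F)) ×-dec ((adj? v x ×-dec adj? v y) ×-dec ¬? (x ≟ y))

  module _ {F : Subset n} (branching : ∀ {v} → v ∈ F → Branching F v) where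

    -- The state of a walk: `tail` remembers the previous vertex, to which the next step must not
    -- return.
    record Arc : Set where
      constructor arc
      field
        {tail head} : Fin n
        head∈F      : head ∈ F
        tail~head   : Adj tail head
    open Arc

    -- Of two distinct neighbours of the head, at least one differs from the tail.
    turn : ∀ (e : Arc) → ∃ λ x → x ∈ F × Adj (head e) x × x ≢ tail e
    turn e with branching (head∈F e)
    ... | x , y , (x∈F , y∈F) , (h~x , h~y) , x≢y with x ≟ tail e
    ... | no  x≢tail = x , x∈F , h~x , x≢tail
    ... | yes x≡tail = y , y∈F , h~y , λ y≡tail → x≢y (trans x≡tail (sym y≡tail))

    arcs : Arc → ℕ → Arc
    arcs e zero    = e
    arcs e (suc i) with turn (arcs e i)
    ... | _ , x∈F , h~x , _ = arc x∈F h~x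

    branching⇒cycle : ∀ {v} → v ∈ F → Cycle G
    branching⇒cycle v∈F with branching v∈F
    ... | _ , _ , (x∈F , _) , (v~x , _) , _ = forward-walk⇒cycle (head ∘ arcs e)
            -- The tail of each arc is the previous head, so avoiding the tail of arc `suc i` means
            -- avoiding the head of arc `i`.
            (λ i → tail~head (arcs e (suc i))) (λ i → proj₂ (proj₂ (proj₂ (turn (arcs e (suc i))))))
      where e = arc x∈F v~x

  -- Otherwise every vertex of `F` branches, and a walk in `F` can continue forever without turning
  -- back.
  leaf-exists : ¬ Cycle G → ∀ {F v} → v ∈ F → ∃ λ l → l ∈ F × l ≤1-neighbour-in F
  leaf-exists acyclic {F} v∈F with any? (λ l → (l ∈? F) ×-dec ¬? (branching? F l))
  ... | yes (l , l∈F , ¬br) = l , l∈F , λ {x} {y} x∈F y∈F l~x l~y →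
          decidable-stable (x ≟ y) λ x≢y → ¬br (x , y , (x∈F , y∈F) , (l~x , l~y) , x≢y)
  ... | no  none = ⊥-elim (acyclic (branching⇒cycle
          (λ {u} u∈F → decidable-stable (branching? F u) λ ¬br → none (u , u∈F , ¬br)) v∈F))

  -- Upper bound: Dominator's strategy in a forest, and its transfer to the game.

  forest-finishes : ¬ Cycle G → ∀ F X → Acc _<_ ∣ F ∣ →
    ∃₂ λ I m → I ⊆ F × Independent G I × m ≤ ∣ I ∣ × FinishesWithin F m X
  forest-finishes acyclic F X (acc rec) with nonempty? F
  ... | no  empty = ⊥ , 0 , ⊥-elim ∘ ∉⊥ , (λ _ _ u∈⊥ → ⊥-elim (∉⊥ u∈⊥)) , z≤n , λ v∈F → ⊥-elim (empty (_ , v∈F))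
  ... | yes (_ , v∈F) with leaf-exists acyclic v∈F
  ... | l , l∈F , leaf with forest-finishes acyclic (F ∖N[ l ]) X
          (rec (p⊂q⇒∣p∣<∣q∣ (proj₁ ∘ ∈-comprehension⁻ (outside? F l) , l , l∈F ,
            λ l∈ → proj₂ (∈-comprehension⁻ (outside? F l) l∈) (inj₁ refl))))
  ... | I , m , I⊆F′ , ind , m≤∣I∣ , r =
          -- The leaf accounts for one more move and one more vertex of `I`; it has no neighbour in
          -- `F ∖N[ l ]`, so independence is kept.
          I ∪ ⁅ l ⁆ , suc m , I∪l⊆F , independent-∪⁅⁆ ind (λ w∈I l~w → ∉N w∈I (inj₂ l~w)) ,
          ≤-trans (s≤s m≤∣I∣) (x∉p⇒∣p∣<∣p∪⁅x⁆∣ (λ l∈I → ∉N l∈I (inj₁ refl))) ,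
          finishes-leaf l∈F leaf m r
    where
    ∉N : ∀ {w} → w ∈ I → ¬ InN[_] G l w
    ∉N w∈I = proj₂ (∈-comprehension⁻ (outside? F l) (I⊆F′ w∈I))

    I∪l⊆F : I ∪ ⁅ l ⁆ ⊆ F
    I∪l⊆F x∈ with x∈p∪q⁻ I ⁅ l ⁆ x∈
    ... | inj₁ x∈I = proj₁ (∈-comprehension⁻ (outside? F l) (I⊆F′ x∈I))
    ... | inj₂ x∈l rewrite x∈⁅y⁆⇒x≡y l x∈l = l∈F

  dominatedSet : Subset n → Subset n
  dominatedSet D = comprehension (dominated? G D)

  all-dominated⇒finalSize≡ : ∀ t D → ⊤ ⊆ dominatedSet D → finalSize G t D ≡ ∣ D ∣
  all-dominated⇒finalSize≡ zero    D _ = refl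
  all-dominated⇒finalSize≡ (suc t) D ⊤⊆ with undominated G D | undominated⁻ D
  ... | []    | _            = refl
  ... | _ ∷ _ | ¬dom All.∷ _ = ⊥-elim (¬dom (∈-comprehension⁻ (dominated? G D) (⊤⊆ ∈⊤)))

  -- The real game is the restricted one on `⊤` in which the adversary declares nothing for free:
  -- `Y` and `Z` are the sets dominated before and after the reply.
  finalSize-≤ : ∀ m t D → FinishesWithin ⊤ m (dominatedSet D) → finalSize G t D ≤ ∣ D ∣ + m
  -- Stopping early yields `∣ D ∣`, within the bound, so `t` and `m` may be unrelated.
  finalSize-≤ _       zero    D _ = m≤m+n _ _
  finalSize-≤ zero    (suc t) D r = ≤-trans (≤-reflexive (all-dominated⇒finalSize≡ (suc t) D r)) (m≤m+n _ _)
  finalSize-≤ (suc m) (suc t) D r with r ⊆-refl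
  ... | inj₁ ⊤⊆ = ≤-trans (≤-reflexive (all-dominated⇒finalSize≡ (suc t) D ⊤⊆)) (m≤m+n _ _)
  ... | inj₂ (v , _ , v∉ , next) =
          indicate-≤ t D (undominated⁺ D (v∉ ∘ ∈-comprehension⁺ (dominated? G D))) (select-≤ t D reply)
    where
    reply : ∀ {w} → InN[_] G v w → finalSize G t (D ∪ ⁅ w ⁆) ≤ ∣ D ∣ + suc m
    reply {w} w∈N = begin
      finalSize G t (D ∪ ⁅ w ⁆) ≤⟨ finalSize-≤ m t (D ∪ ⁅ w ⁆) (next ∈⊤ w∈N old new) ⟩
      ∣ D ∪ ⁅ w ⁆ ∣ + m         ≤⟨ +-monoˡ-≤ m (∣p∪⁅x⁆∣≤1+∣p∣ D w) ⟩
      suc ∣ D ∣ + m             ≡⟨ +-suc ∣ D ∣ m ⟨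
      ∣ D ∣ + suc m             ∎
      where
      open ≤-Reasoning
      old : dominatedSet D ⊆ dominatedSet (D ∪ ⁅ w ⁆)
      old u∈ with ∈-comprehension⁻ (dominated? G D) u∈
      ... | x , x∈D , x∈N = ∈-comprehension⁺ (dominated? G (D ∪ ⁅ w ⁆)) (x , p⊆p∪q ⁅ w ⁆ x∈D , x∈N)

      new : ∀ {u} → u ∈ ⊤ → InN[_] G w u → u ∈ dominatedSet (D ∪ ⁅ w ⁆)
      new _ u∈N = ∈-comprehension⁺ (dominated? G (D ∪ ⁅ w ⁆)) (w , q⊆p∪q D ⁅ w ⁆ (x∈⁅x⁆ w) , InN-sym u∈N)

  acyclic⇒γᵢ≤α : ¬ Cycle G → γᵢ G ≤ α G
  acyclic⇒γᵢ≤α acyclic with forest-finishes acyclic ⊤ (dominatedSet ⊥) (<-wellFounded _)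
  ... | I , m , _ , ind , m≤∣I∣ , r = begin
    γᵢ G            ≤⟨ finalSize-≤ m n ⊥ r ⟩
    ∣ ⊥ {n} ∣ + m   ≡⟨ cong (_+ m) (∣⊥∣≡0 n) ⟩
    m               ≤⟨ m≤∣I∣ ⟩
    ∣ I ∣           ≤⟨ α-upper G I ind ⟩
    α G             ∎
    where open ≤-Reasoning

theorem5p2 : ∀ (n : ℕ) (T : Graph n) → IsTree T → γᵢ T ≡ α T
theorem5p2 n T tree = ≤-antisym (acyclic⇒γᵢ≤α T (IsTree.acyclic tree)) (α≤γᵢ T)
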